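{- For every positive integer $k$ there exists a finite family of strings in the plane whose disjointness graph $G$ is triangle-free and satisfies $\chi(G)\ge k$. Moreover, the strings can be chosen to be simple polygonal paths each consisting of at most $4$ segments.
   Context: A string is a continuous arc in the plane. The disjointness graph of a family of sets is the graph whose vertices are the members, two adjacent iff the corresponding sets are disjoint. $\chi$ denotes the chromatic number.
   Formalization: The plane is the rational plane: the vertices of the polygonal paths are rational, and disjointness and simplicity are tested at rational points only; for segments with rational endpoints this agrees with the real plane. -}

module Defs where

open import Data.Nat using (ℕ; zero; suc) renaming (_≤_ to _≤ℕ_; _<_ to _<ℕ_)
open import Data.Fin using (Fin; toℕ; inject₁) renaming (suc to fsuc)
open import Data.Rational using (ℚ; 0ℚ; 1ℚ; _+_; _*_; _-_; _≤_)
open import Data.Product using (_×_; _,_; Σ; ∃; ∃-syntax)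
open import Relation.Binary.PropositionalEquality using (_≡_; _≢_)
open import Relation.Nullary using (¬_)
open import Data.Empty using (⊥)

Point : Set
Point = ℚ × ℚ

OnSegment : Point → Point → Point → Set
OnSegment (px , py) (ax , ay) (bx , by) =
  Σ ℚ λ t → (0ℚ ≤ t) × (t ≤ 1ℚ) ×
    (px ≡ ax + t * (bx - ax)) × (py ≡ ay + t * (by - ay))

record Path : Set where
  field
    segs   : ℕ
    segs≥1 : 1 ≤ℕ segs
    segs≤4 : segs ≤ℕ 4
    vert   : Fin (suc segs) → Point

  OnSeg : Point → Fin segs → Set
  OnSeg p i = OnSegment p (vert (inject₁ i)) (vert (fsuc i))

  On : Point → Set
  On p = Σ (Fin segs) λ i → OnSeg p i

open Path public

record Simple (P : Path) : Set where
  field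
    nondeg   : ∀ (i : Fin (segs P)) → vert P (inject₁ i) ≢ vert P (fsuc i)
    adjacent : ∀ (i j : Fin (segs P)) (p : Point) → toℕ j ≡ suc (toℕ i) →
               OnSeg P p i → OnSeg P p j → p ≡ vert P (fsuc i)
    far      : ∀ (i j : Fin (segs P)) (p : Point) → suc (toℕ i) <ℕ toℕ j →
               OnSeg P p i → OnSeg P p j → ⊥

Disjoint : Path → Path → Set
Disjoint P Q = ¬ (Σ Point λ p → On P p × On Q p)

DisjAdj : ∀ {n} → (Fin n → Path) → Fin n → Fin n → Set
DisjAdj S i j = (i ≢ j) × Disjoint (S i) (S j)

DisjTriangleFree : ∀ {n} → (Fin n → Path) → Set
DisjTriangleFree {n} S =
  ∀ (a b c : Fin n) → DisjAdj S a b → DisjAdj S b c → DisjAdj S a c → ⊥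

ProperColouring : ∀ {n} → (Fin n → Path) → (m : ℕ) → (Fin n → Fin m) → Set
ProperColouring {n} S m c = ∀ (i j : Fin n) → DisjAdj S i j → c i ≢ c j

ChromaticAtLeast : ∀ {n} → (Fin n → Path) → ℕ → Set
ChromaticAtLeast {n} S k =
  ∀ (m : ℕ) → m <ℕ k → (c : Fin n → Fin m) → ¬ ProperColouring S m c

{-# OPTIONS --safe #-}
module Submission where

-- The shift graph on the pairs i < j ≤ N, with edges (i , j) — (j , l), is
-- triangle-free, and mapping h to the set of colours of the pairs (h , _) is
-- injective for every proper colouring, so m colours suffice only if N ≤ 2 ^ m.
--
-- The pair (i , j) becomes the path through (with τ j large and τ j + 2j decreasing)
--   (τ 0 , 2i+1)  (2i+1 , 2i+1)  (2j , 2j)  (2j , τ j + 2)  (τ j , 2j+2).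
-- The diagonal pieces behave like the intervals [2i+1 , 2j]: overlapping ones
-- meet, those of (i , j) and (j , l) do not.  For j < k the last, antidiagonal
-- segment of (i , j) crosses the horizontal first segment of (k , l), but it
-- stops just above the first segment of (j , l).  Disjointness is certified by
-- the separating functionals x, y and x + y.

open import Defs
open import Data.Nat using (ℕ; _≤_; zero; suc; _<_; z≤n; s≤s; _∸_; _^_)
  renaming (_+_ to _+ℕ_; _*_ to _*ℕ_)
import Data.Nat.Properties as ℕₚ
open import Data.Nat.Tactic.RingSolver using (solve-∀)
open import Data.Fin using (Fin; zero; suc; toℕ; fromℕ<; combine; remQuot; funToFin; finToFun; inject₁)
import Data.Fin.Properties as Finₚ
open import Data.Product using (Σ; _×_; _,_; proj₁; proj₂; ∃)
open import Data.Sum using (_⊎_; inj₁; inj₂)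
open import Data.Empty using (⊥; ⊥-elim)
open import Data.Rational using (ℚ; 0ℚ; 1ℚ; _+_; _*_; _-_; -_; 1/_; NonZero; Positive; nonNegative; positive)
  renaming (_≤_ to _≤ℚ_; _<_ to _<ℚ_)
import Data.Rational.Properties as ℚₚ
open import Algebra.Properties.Group ℚₚ.+-0-group using (∙-cancelˡ)
open import Data.Rational.Solver using (module +-*-Solver)
open import Function using (_∘_)
open import Relation.Binary.Definitions using (tri<; tri≈; tri>)
open import Relation.Binary.PropositionalEquality
open import Relation.Nullary using (¬_; Dec; yes; no)
open import Relation.Nullary.Decidable using (_×-dec_)

-- Colour sets and the chromatic number of the shift graph

indicator : ∀ {P : Set} → Dec P → Fin 2
indicator (yes _) = suc zero
indicator (no _)  = zero

indicator-⇒ : ∀ {P Q : Set} (p? : Dec P) (q? : Dec Q) → indicator p? ≡ indicator q? → P → Q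
indicator-⇒ _       (yes q) _ _ = q
indicator-⇒ (no ¬p) (no _)  _ p = ⊥-elim (¬p p)

-- For `h < i` the colour `c h i` is used at `h`. If it were also used at `i`, by some pair
-- `(i , j)`, that pair would share its colour with its neighbour `(h , i)`. So distinct starts have
-- distinct colour sets.
shift-colouring-bound : ∀ {n m} (c : Fin n → Fin n → Fin m) →
  (∀ h i j → toℕ h < toℕ i → toℕ i < toℕ j → c h i ≢ c i j) → n ≤ 2 ^ m
shift-colouring-bound {n} {m} c proper = ℕₚ.≮⇒≥ impossible
  where
  Used : Fin n → Fin m → Set
  Used h γ = ∃ λ i → toℕ h < toℕ i × c h i ≡ γ

  used? : ∀ h γ → Dec (Used h γ)
  used? h γ = Finₚ.any? λ i → (toℕ h ℕₚ.<? toℕ i) ×-dec (c h i Finₚ.≟ γ)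

  usedSet : Fin n → Fin m → Fin 2
  usedSet h γ = indicator (used? h γ)

  impossible : ¬ (2 ^ m < n)
  -- `funToFin` codes a subset of the colours, given by its `Fin 2`-valued indicator, as an element
  -- of `Fin (2 ^ m)`.
  impossible 2^m<n with Finₚ.pigeonhole 2^m<n (funToFin ∘ usedSet)
  ... | h , i , h<i , eq =
    let γ = c h i
        same = begin
          usedSet h γ                      ≡⟨ Finₚ.finToFun-funToFin (usedSet h) γ ⟨
          finToFun (funToFin (usedSet h)) γ ≡⟨ cong (λ s → finToFun s γ) eq ⟩
          finToFun (funToFin (usedSet i)) γ ≡⟨ Finₚ.finToFun-funToFin (usedSet i) γ ⟩
          usedSet i γ                      ∎
        j , i<j , cij = indicator-⇒ (used? h γ) (used? i γ) same (i , h<i , refl)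
    in proper h i j h<i i<j (sym cij)
    where open ≡-Reasoning

-- Natural numbers inside the rationals

ι : ℕ → ℚ
ι zero    = 0ℚ
ι (suc n) = 1ℚ + ι n

ι-+ : ∀ m n → ι (m +ℕ n) ≡ ι m + ι n
ι-+ zero    n = sym (ℚₚ.+-identityˡ (ι n))
ι-+ (suc m) n = trans (cong (1ℚ +_) (ι-+ m n)) (sym (ℚₚ.+-assoc 1ℚ (ι m) (ι n)))

0<1 : 0ℚ <ℚ 1ℚ
0<1 = ℚₚ.positive⁻¹ 1ℚ

0≤ι : ∀ n → 0ℚ ≤ℚ ι n
0≤ι zero    = ℚₚ.≤-refl
0≤ι (suc n) = ℚₚ.+-mono-≤ (ℚₚ.<⇒≤ 0<1) (0≤ι n)

ι-mono-≤ : ∀ {m n} → m ≤ n → ι m ≤ℚ ι n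
ι-mono-≤ {n = n} z≤n = 0≤ι n
ι-mono-≤ (s≤s m≤n)   = ℚₚ.+-monoʳ-≤ 1ℚ (ι-mono-≤ m≤n)

ι-mono-< : ∀ {m n} → m < n → ι m <ℚ ι n
ι-mono-< {m} (s≤s {n = n} m≤n) =
  subst (_<ℚ 1ℚ + ι n) (ℚₚ.+-identityˡ (ι m)) (ℚₚ.+-mono-<-≤ 0<1 (ι-mono-≤ m≤n))

ι-<-≢ : ∀ {m n} → m < n → ι m ≢ ι n
ι-<-≢ m<n eq = ℚₚ.<-irrefl eq (ι-mono-< m<n)

-- Linear interpolation

lerp-convex : ∀ t a b → a + t * (b - a) ≡ (1ℚ - t) * a + t * b
lerp-convex = solve 3 (λ t a b → a :+ t :* (b :- a) := (con 1ℚ :- t) :* a :+ t :* b) refl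
  where open +-*-Solver

lerp-idem : ∀ t a → a ≡ a + t * (a - a)
lerp-idem = solve 2 (λ t a → a := a :+ t :* (a :- a)) refl
  where open +-*-Solver

lerp-+ : ∀ t a b c d →
  (a + t * (b - a)) + (c + t * (d - c)) ≡ (a + c) + t * ((b + d) - (a + c))
lerp-+ = solve 5 (λ t a b c d →
  (a :+ t :* (b :- a)) :+ (c :+ t :* (d :- c)) := (a :+ c) :+ t :* ((b :+ d) :- (a :+ c))) refl
  where open +-*-Solver

lerp-mono-≤ : ∀ {t a b c d} → 0ℚ ≤ℚ t → t ≤ℚ 1ℚ → a ≤ℚ c → b ≤ℚ d →
  a + t * (b - a) ≤ℚ c + t * (d - c)
lerp-mono-≤ {t} {a} {b} {c} {d} 0≤t t≤1 a≤c b≤d =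
  subst₂ _≤ℚ_ (sym (lerp-convex t a b)) (sym (lerp-convex t c d))
    (ℚₚ.+-mono-≤
      (ℚₚ.*-monoˡ-≤-nonNeg (1ℚ - t) {{nonNegative 0≤1-t}} a≤c)
      (ℚₚ.*-monoˡ-≤-nonNeg t {{nonNegative 0≤t}} b≤d))
  where
  0≤1-t : 0ℚ ≤ℚ 1ℚ - t
  0≤1-t = subst (_≤ℚ 1ℚ - t) (ℚₚ.+-inverseʳ t) (ℚₚ.+-monoˡ-≤ (- t) t≤1)

lerp-≤ : ∀ {t a b m} → 0ℚ ≤ℚ t → t ≤ℚ 1ℚ → a ≤ℚ m → b ≤ℚ m → a + t * (b - a) ≤ℚ m
lerp-≤ {t} {m = m} 0≤t t≤1 a≤m b≤m =
  -- The constant bound is itself an interpolation, from `m` to `m`.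
  subst (_ ≤ℚ_) (sym (lerp-idem t m)) (lerp-mono-≤ 0≤t t≤1 a≤m b≤m)

lerp-≥ : ∀ {t a b m} → 0ℚ ≤ℚ t → t ≤ℚ 1ℚ → m ≤ℚ a → m ≤ℚ b → m ≤ℚ a + t * (b - a)
lerp-≥ {t} {m = m} 0≤t t≤1 m≤a m≤b =
  subst (_≤ℚ _) (sym (lerp-idem t m)) (lerp-mono-≤ 0≤t t≤1 m≤a m≤b)

-- Linear functionals on segments between lattice points

Lattice : Set
Lattice = ℕ × ℕ

embed : Lattice → Point
embed (x , y) = ι x , ι y

data Functional : Set where
  X Y X+Y : Functional

⟦_⟧ : Functional → Point → ℚ
⟦ X   ⟧ (x , y) = x
⟦ Y   ⟧ (x , y) = y
⟦ X+Y ⟧ (x , y) = x + y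

⟦_⟧ₙ : Functional → Lattice → ℕ
⟦ X   ⟧ₙ (x , y) = x
⟦ Y   ⟧ₙ (x , y) = y
⟦ X+Y ⟧ₙ (x , y) = x +ℕ y

⟦⟧-embed : ∀ f q → ⟦ f ⟧ (embed q) ≡ ι (⟦ f ⟧ₙ q)
⟦⟧-embed X   q       = refl
⟦⟧-embed Y   q       = refl
⟦⟧-embed X+Y (x , y) = sym (ι-+ x y)

⟦⟧-lerp : ∀ f {p} a b ((t , _) : OnSegment p a b) → ⟦ f ⟧ p ≡ ⟦ f ⟧ a + t * (⟦ f ⟧ b - ⟦ f ⟧ a)
⟦⟧-lerp X   a b (t , _ , _ , ex , ey) = ex
⟦⟧-lerp Y   a b (t , _ , _ , ex , ey) = ey
⟦⟧-lerp X+Y (ax , ay) (bx , by) (t , _ , _ , ex , ey) =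
  trans (cong₂ _+_ ex ey) (lerp-+ t ax bx ay by)

-- A functional is affine along a segment, so a bound at both ends, checked in ℕ, holds throughout.
segment-≤ : ∀ f a b {p m} → OnSegment p (embed a) (embed b) →
  ⟦ f ⟧ₙ a ≤ m → ⟦ f ⟧ₙ b ≤ m → ⟦ f ⟧ p ≤ℚ ι m
segment-≤ f a b {m = m} on@(t , 0≤t , t≤1 , _) a≤m b≤m =
  subst (_≤ℚ ι m) (sym (⟦⟧-lerp f (embed a) (embed b) on))
    (lerp-≤ 0≤t t≤1 (endpoint a a≤m) (endpoint b b≤m))
  where
  endpoint : ∀ q → ⟦ f ⟧ₙ q ≤ m → ⟦ f ⟧ (embed q) ≤ℚ ι m
  endpoint q q≤m = subst (_≤ℚ ι m) (sym (⟦⟧-embed f q)) (ι-mono-≤ q≤m)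

segment-≥ : ∀ f a b {p m} → OnSegment p (embed a) (embed b) →
  m ≤ ⟦ f ⟧ₙ a → m ≤ ⟦ f ⟧ₙ b → ι m ≤ℚ ⟦ f ⟧ p
segment-≥ f a b {m = m} on@(t , 0≤t , t≤1 , _) m≤a m≤b =
  subst (ι m ≤ℚ_) (sym (⟦⟧-lerp f (embed a) (embed b) on))
    (lerp-≥ 0≤t t≤1 (endpoint a m≤a) (endpoint b m≤b))
  where
  endpoint : ∀ q → m ≤ ⟦ f ⟧ₙ q → ι m ≤ℚ ⟦ f ⟧ (embed q)
  endpoint q m≤q = subst (ι m ≤ℚ_) (sym (⟦⟧-embed f q)) (ι-mono-≤ m≤q)

-- Closes the disjointness arguments: `q` is the value of a functional at a supposed common point.
separated : ∀ {q m n} → q ≤ℚ ι m → ι n ≤ℚ q → m < n → ⊥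
separated q≤m n≤q m<n = ℚₚ.<-irrefl refl (ℚₚ.<-≤-trans (ι-mono-< m<n) (ℚₚ.≤-trans n≤q q≤m))

-- Exhibiting lattice points on segments

ratio : ∀ d e → 0 < d +ℕ e → Σ ℚ λ t → (0ℚ ≤ℚ t) × (t ≤ℚ 1ℚ) × (t * ι (d +ℕ e) ≡ ι d)
ratio d e 0<D = t , 0≤t , t≤1 , tD≡d
  where
  D = ι (d +ℕ e)
  instance
    D-pos : Positive D
    D-pos = positive (ι-mono-< 0<D)
    D-nonZero : NonZero D
    D-nonZero = ℚₚ.pos⇒nonZero D
  -- The parameter `d / (d + e)` of the point that cuts a segment into pieces of lengths `d` and
  -- `e`.
  t = ι d * (1/ D)
  tD≡d : t * D ≡ ι d
  tD≡d = trans (ℚₚ.*-assoc (ι d) (1/ D) D)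
         (trans (cong (ι d *_) (ℚₚ.*-inverseˡ D)) (ℚₚ.*-identityʳ (ι d)))
  0≤t : 0ℚ ≤ℚ t
  0≤t = ℚₚ.*-cancelʳ-≤-pos D (subst₂ _≤ℚ_ (sym (ℚₚ.*-zeroˡ D)) (sym tD≡d) (0≤ι d))
  t≤1 : t ≤ℚ 1ℚ
  t≤1 = ℚₚ.*-cancelʳ-≤-pos D
    (subst₂ _≤ℚ_ (sym tD≡d) (sym (ℚₚ.*-identityˡ D)) (ι-mono-≤ (ℕₚ.m≤m+n d e)))

lerp-up : ∀ t a d e → t * ι (d +ℕ e) ≡ ι d →
  ι (a +ℕ d) ≡ ι a + t * (ι (a +ℕ (d +ℕ e)) - ι a)
lerp-up t a d e tD≡d = begin
  ι (a +ℕ d)                               ≡⟨ ι-+ a d ⟩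
  ι a + ι d                                ≡⟨ cong (ι a +_) tD≡d ⟨
  ι a + t * ι (d +ℕ e)                     ≡⟨ identity t (ι a) (ι (d +ℕ e)) ⟩
  ι a + t * ((ι a + ι (d +ℕ e)) - ι a)     ≡⟨ cong (λ q → ι a + t * (q - ι a)) (ι-+ a (d +ℕ e)) ⟨
  ι a + t * (ι (a +ℕ (d +ℕ e)) - ι a)      ∎
  where
  open ≡-Reasoning
  identity : ∀ t a D → a + t * D ≡ a + t * ((a + D) - a)
  identity = solve 3 (λ t a D → a :+ t :* D := a :+ t :* ((a :+ D) :- a)) refl
    where open +-*-Solver

lerp-down : ∀ t b d e → t * ι (d +ℕ e) ≡ ι d →
  ι (b +ℕ e) ≡ ι (b +ℕ (d +ℕ e)) + t * (ι b - ι (b +ℕ (d +ℕ e)))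
lerp-down t b d e tD≡d = begin
  ι (b +ℕ e)                            ≡⟨ ι-+ b e ⟩
  ι b + ι e                             ≡⟨ shift (ι b) (ι d) (ι e) ⟩
  (ι b + (ι d + ι e)) - ι d             ≡⟨ cong (λ q → (ι b + q) - ι d) (ι-+ d e) ⟨
  (ι b + ι D) - ι d                     ≡⟨ cong (λ q → (ι b + ι D) - q) tD≡d ⟨
  (ι b + ι D) - t * ι D                 ≡⟨ identity t (ι b) (ι D) ⟩
  (ι b + ι D) + t * (ι b - (ι b + ι D)) ≡⟨ cong (λ q → q + t * (ι b - q)) (ι-+ b D) ⟨
  ι (b +ℕ D) + t * (ι b - ι (b +ℕ D))   ∎
  where
  open ≡-Reasoning
  D = d +ℕ e
  shift : ∀ b d e → b + e ≡ (b + (d + e)) - d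
  shift = solve 3 (λ b d e → b :+ e := (b :+ (d :+ e)) :- d) refl
    where open +-*-Solver
  identity : ∀ t b D → (b + D) - t * D ≡ (b + D) + t * (b - (b + D))
  identity = solve 3 (λ t b D → (b :+ D) :- t :* D := (b :+ D) :+ t :* (b :- (b :+ D))) refl
    where open +-*-Solver

-- Here and in the next two lemmas the point is given by the coordinate lengths `d` and `e` of the
-- two pieces, which avoids subtraction in ℕ.
leftward-∋ : ∀ b d e y → 0 < d +ℕ e →
  OnSegment (embed (b +ℕ e , y)) (embed (b +ℕ (d +ℕ e) , y)) (embed (b , y))
leftward-∋ b d e y 0<D =
  let t , 0≤t , t≤1 , tD≡d = ratio d e 0<D
  in t , 0≤t , t≤1 , lerp-down t b d e tD≡d , lerp-idem t (ι y)

diagonal-∋ : ∀ a d e → 0 < d +ℕ e →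
  OnSegment (embed (a +ℕ d , a +ℕ d)) (embed (a , a)) (embed (a +ℕ (d +ℕ e) , a +ℕ (d +ℕ e)))
diagonal-∋ a d e 0<D =
  let t , 0≤t , t≤1 , tD≡d = ratio d e 0<D
  in t , 0≤t , t≤1 , lerp-up t a d e tD≡d , lerp-up t a d e tD≡d

antidiagonal-∋ : ∀ x y d e → 0 < d +ℕ e →
  OnSegment (embed (x +ℕ d , y +ℕ e)) (embed (x , y +ℕ (d +ℕ e))) (embed (x +ℕ (d +ℕ e) , y))
antidiagonal-∋ x y d e 0<D =
  let t , 0≤t , t≤1 , tD≡d = ratio d e 0<D
  in t , 0≤t , t≤1 , lerp-up t x d e tD≡d , lerp-down t y d e tD≡d

-- Even and odd coordinates

even odd : ℕ → ℕ
even n = n +ℕ n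
odd n  = suc (even n)

even-mono-≤ : ∀ {m n} → m ≤ n → even m ≤ even n
even-mono-≤ m≤n = ℕₚ.+-mono-≤ m≤n m≤n

odd<even : ∀ {m n} → m < n → odd m < even n
odd<even {m} {n} m<n = subst (_≤ even n) (cong suc (ℕₚ.+-suc m m)) (even-mono-≤ m<n)

odd-mono-< : ∀ {m n} → m < n → odd m < odd n
odd-mono-< m<n = ℕₚ.m≤n⇒m≤1+n (odd<even m<n)

-- The paths and estimates for their corners

module Strings (N : ℕ) where

  -- This is `4N + 1 + 3(N - j)`. Exceeding `4N` keeps the antidiagonal crossings to the right of
  -- the diagonal; the factor 3 makes `τ j + 2j` decrease strictly.
  τ : ℕ → ℕ
  τ j = suc (even (even N)) +ℕ ((N ∸ j) +ℕ even (N ∸ j))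

  corner : ℕ → ℕ → Fin 5 → Lattice
  corner i j zero                         = τ 0 , odd i
  corner i j (suc zero)                   = odd i , odd i
  corner i j (suc (suc zero))             = even j , even j
  corner i j (suc (suc (suc zero)))       = even j , suc (suc (τ j))
  corner i j (suc (suc (suc (suc zero)))) = τ j , suc (suc (even j))

  pattern seg₀ = zero
  pattern seg₁ = suc zero
  pattern seg₂ = suc (suc zero)
  pattern seg₃ = suc (suc (suc zero))

  path : ℕ → ℕ → Path
  path i j = record
    { segs   = 4
    ; segs≥1 = s≤s z≤n
    ; segs≤4 = ℕₚ.≤-refl
    ; vert   = λ v → embed (corner i j v)
    }

  -- The constant value of `x + y` on the last segment, computed at its upper end.
  level : ℕ → ℕ
  level j = even j +ℕ suc (suc (τ j))

  level-corner₄ : ∀ j → τ j +ℕ suc (suc (even j)) ≡ level j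
  level-corner₄ j = swap (τ j) (even j)
    where
    swap : ∀ t e → t +ℕ suc (suc e) ≡ e +ℕ suc (suc t)
    swap = solve-∀

  -- Since `2j + 3(N - j) = 2N + (N - j)`, the level is `7N + 3 - j`.
  level-closed : ∀ {j} → j ≤ N → level j ≡ suc (suc (suc (even (even N) +ℕ even N))) +ℕ (N ∸ j)
  level-closed {j} j≤N =
    trans (rearrange j (N ∸ j) (even (even N)))
          (cong (λ n → suc (suc (suc (even (even N) +ℕ even n))) +ℕ (N ∸ j)) (ℕₚ.m+[n∸m]≡n j≤N))
    where
    rearrange : ∀ j r c → (j +ℕ j) +ℕ suc (suc (suc c +ℕ (r +ℕ (r +ℕ r))))
                        ≡ suc (suc (suc (c +ℕ ((j +ℕ r) +ℕ (j +ℕ r))))) +ℕ r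
    rearrange = solve-∀

  level-anti-< : ∀ {j l} → j < l → l ≤ N → level l < level j
  level-anti-< {j} {l} j<l l≤N =
    subst₂ _<_ (sym (level-closed l≤N)) (sym (level-closed (ℕₚ.≤-trans (ℕₚ.<⇒≤ j<l) l≤N)))
      (ℕₚ.+-monoʳ-< (suc (suc (suc (even (even N) +ℕ even N)))) (ℕₚ.∸-monoʳ-< j<l l≤N))

  evenevenN<τ : ∀ j → even (even N) < τ j
  evenevenN<τ j = ℕₚ.m≤m+n (suc (even (even N))) _

  ≤evenN⇒<τ : ∀ {m} j → m ≤ even N → m < τ j
  ≤evenN⇒<τ j m≤ = ℕₚ.≤-<-trans (ℕₚ.≤-trans m≤ (ℕₚ.m≤m+n (even N) (even N))) (evenevenN<τ j)

  -- Horizontal segments start at `τ 0`, so they extend at least as far right as every antidiagonal.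
  τ≤τ0 : ∀ j → τ j ≤ τ 0
  τ≤τ0 j = ℕₚ.+-monoʳ-≤ (suc (even (even N)))
             (ℕₚ.+-mono-≤ (ℕₚ.m∸n≤m N j) (even-mono-≤ (ℕₚ.m∸n≤m N j)))

  τ≤level : ∀ j → τ j ≤ level j
  τ≤level j = ℕₚ.≤-trans (ℕₚ.≤-trans (ℕₚ.n≤1+n _) (ℕₚ.n≤1+n _)) (ℕₚ.m≤n+m _ (even j))

  seg-≤ : ∀ f i j (s : Fin 4) m {p} → OnSeg (path i j) p s →
    ⟦ f ⟧ₙ (corner i j (inject₁ s)) ≤ m → ⟦ f ⟧ₙ (corner i j (suc s)) ≤ m → ⟦ f ⟧ p ≤ℚ ι m
  seg-≤ f i j s m = segment-≤ f (corner i j (inject₁ s)) (corner i j (suc s))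

  seg-≥ : ∀ f i j (s : Fin 4) m {p} → OnSeg (path i j) p s →
    m ≤ ⟦ f ⟧ₙ (corner i j (inject₁ s)) → m ≤ ⟦ f ⟧ₙ (corner i j (suc s)) → ι m ≤ℚ ⟦ f ⟧ p
  seg-≥ f i j s m = segment-≥ f (corner i j (inject₁ s)) (corner i j (suc s))

  seg-≡ : ∀ f i j (s : Fin 4) m {p} → OnSeg (path i j) p s →
    ⟦ f ⟧ₙ (corner i j (inject₁ s)) ≡ m → ⟦ f ⟧ₙ (corner i j (suc s)) ≡ m → ⟦ f ⟧ p ≡ ι m
  seg-≡ f i j s m on a≡m b≡m =
    ℚₚ.≤-antisym (seg-≤ f i j s m on (ℕₚ.≤-reflexive a≡m) (ℕₚ.≤-reflexive b≡m))
                 (seg-≥ f i j s m on (ℕₚ.≤-reflexive (sym a≡m)) (ℕₚ.≤-reflexive (sym b≡m)))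

  diagonal-x≡y : ∀ i j {p} → OnSeg (path i j) p seg₁ → proj₁ p ≡ proj₂ p
  diagonal-x≡y i j (_ , _ , _ , ex , ey) = trans ex (sym ey)

  path-≥ : ∀ f i j m {p} → (∀ v → m ≤ ⟦ f ⟧ₙ (corner i j v)) → On (path i j) p → ι m ≤ℚ ⟦ f ⟧ p
  path-≥ f i j m m≤ (s , on) = seg-≥ f i j s m on (m≤ (inject₁ s)) (m≤ (suc s))

  module _ {i j : ℕ} (i<j : i < j) (j≤N : j ≤ N) where

    odd-i≤evenN : odd i ≤ even N
    odd-i≤evenN = ℕₚ.≤-trans (ℕₚ.<⇒≤ (odd<even i<j)) (even-mono-≤ j≤N)

    even-j<τ : even j < τ j
    even-j<τ = ≤evenN⇒<τ j (even-mono-≤ j≤N)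

    corner-X≥ : ∀ v → odd i ≤ ⟦ X ⟧ₙ (corner i j v)
    corner-X≥ zero                         = ℕₚ.<⇒≤ (≤evenN⇒<τ 0 odd-i≤evenN)
    corner-X≥ (suc zero)                   = ℕₚ.≤-refl
    corner-X≥ (suc (suc zero))             = ℕₚ.<⇒≤ (odd<even i<j)
    corner-X≥ (suc (suc (suc zero)))       = ℕₚ.<⇒≤ (odd<even i<j)
    corner-X≥ (suc (suc (suc (suc zero)))) = ℕₚ.<⇒≤ (≤evenN⇒<τ j odd-i≤evenN)

    corner-Y≥ : ∀ v → odd i ≤ ⟦ Y ⟧ₙ (corner i j v)
    corner-Y≥ zero                         = ℕₚ.≤-refl
    corner-Y≥ (suc zero)                   = ℕₚ.≤-refl
    corner-Y≥ (suc (suc zero))             = ℕₚ.<⇒≤ (odd<even i<j)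
    corner-Y≥ (suc (suc (suc zero)))       = ℕₚ.m≤n⇒m≤o+n 2 (ℕₚ.<⇒≤ (≤evenN⇒<τ j odd-i≤evenN))
    corner-Y≥ (suc (suc (suc (suc zero)))) = ℕₚ.m≤n⇒m≤o+n 2 (ℕₚ.<⇒≤ (odd<even i<j))

    -- The starting corner is left out: with `x = τ 0` its coordinate sum may exceed the level.
    after-first-X+Y≤ : ∀ (v : Fin 4) → ⟦ X+Y ⟧ₙ (corner i j (suc v)) ≤ level j
    after-first-X+Y≤ zero =
      ℕₚ.≤-trans (ℕₚ.+-mono-≤ odd-i≤evenN odd-i≤evenN)
        (ℕₚ.≤-trans (ℕₚ.<⇒≤ (evenevenN<τ j)) (τ≤level j))
    after-first-X+Y≤ (suc zero) =
      ℕₚ.+-monoʳ-≤ (even j) (ℕₚ.m≤n⇒m≤o+n 2 (ℕₚ.<⇒≤ even-j<τ))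
    after-first-X+Y≤ (suc (suc zero))       = ℕₚ.≤-refl
    after-first-X+Y≤ (suc (suc (suc zero))) = ℕₚ.≤-reflexive (level-corner₄ j)

    -- Simplicity of the paths

    simple : Simple (path i j)
    simple = record { nondeg = nondeg′ ; adjacent = adjacent′ ; far = far′ }
      where
      nondeg′ : ∀ (s : Fin 4) → embed (corner i j (inject₁ s)) ≢ embed (corner i j (suc s))
      nondeg′ seg₀ eq = ι-<-≢ (≤evenN⇒<τ 0 odd-i≤evenN) (sym (cong proj₁ eq))
      nondeg′ seg₁ eq = ι-<-≢ (odd<even i<j) (cong proj₁ eq)
      nondeg′ seg₂ eq = ι-<-≢ (ℕₚ.m≤n⇒m≤o+n 2 even-j<τ) (cong proj₂ eq)
      nondeg′ seg₃ eq = ι-<-≢ even-j<τ (cong proj₁ eq)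

      adjacent′ : ∀ (s s′ : Fin 4) p → toℕ s′ ≡ suc (toℕ s) →
        OnSeg (path i j) p s → OnSeg (path i j) p s′ → p ≡ embed (corner i j (suc s))
      adjacent′ seg₀ seg₁ p _ on on′ = cong₂ _,_ (trans (diagonal-x≡y i j on′) y≡) y≡
        where
        y≡ : proj₂ p ≡ ι (odd i)
        y≡ = seg-≡ Y i j seg₀ (odd i) on refl refl
      adjacent′ seg₁ seg₂ p _ on on′ = cong₂ _,_ x≡ (trans (sym (diagonal-x≡y i j on)) x≡)
        where
        x≡ : proj₁ p ≡ ι (even j)
        x≡ = seg-≡ X i j seg₂ (even j) on′ refl refl
      adjacent′ seg₂ seg₃ p _ on on′ = cong₂ _,_ x≡ y≡
        where
        x≡ : proj₁ p ≡ ι (even j)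
        x≡ = seg-≡ X i j seg₂ (even j) on refl refl
        y≡ : proj₂ p ≡ ι (suc (suc (τ j)))
        -- On the antidiagonal `x + y` is known, and `x` is known from the vertical segment;
        -- cancelling gives `y`.
        y≡ = ∙-cancelˡ (ι (even j)) _ _ (trans (cong (_+ proj₂ p) (sym x≡))
               (trans (seg-≡ X+Y i j seg₃ (level j) on′ refl (level-corner₄ j))
                      (ι-+ (even j) (suc (suc (τ j))))))
      adjacent′ _ seg₀ p ()
      adjacent′ seg₀ (suc (suc _)) p ()
      adjacent′ seg₁ seg₁ p ()
      adjacent′ seg₁ seg₃ p ()
      adjacent′ seg₂ seg₁ p ()
      adjacent′ seg₂ seg₂ p ()
      adjacent′ seg₃ seg₁ p ()
      adjacent′ seg₃ seg₂ p ()
      adjacent′ seg₃ seg₃ p ()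

      far′ : ∀ (s s′ : Fin 4) p → suc (toℕ s) < toℕ s′ →
        OnSeg (path i j) p s → OnSeg (path i j) p s′ → ⊥
      far′ seg₀ seg₂ p _ on on′ =
        separated (seg-≤ Y i j seg₀ (odd i) on ℕₚ.≤-refl ℕₚ.≤-refl)
          (seg-≥ Y i j seg₂ (even j) on′ ℕₚ.≤-refl (ℕₚ.m≤n⇒m≤o+n 2 (ℕₚ.<⇒≤ even-j<τ)))
          (odd<even i<j)
      far′ seg₀ seg₃ p _ on on′ =
        separated (seg-≤ Y i j seg₀ (odd i) on ℕₚ.≤-refl ℕₚ.≤-refl)
          (seg-≥ Y i j seg₃ (even j) on′ (ℕₚ.m≤n⇒m≤o+n 2 (ℕₚ.<⇒≤ even-j<τ))
            (ℕₚ.m≤n⇒m≤1+n (ℕₚ.n≤1+n _)))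
          (odd<even i<j)
      far′ seg₁ seg₃ p _ on on′ =
        separated (seg-≤ Y i j seg₁ (even j) on (ℕₚ.<⇒≤ (odd<even i<j)) ℕₚ.≤-refl)
          (seg-≥ Y i j seg₃ (suc (even j)) on′ (ℕₚ.m≤n⇒m≤o+n 2 even-j<τ) (ℕₚ.n≤1+n _))
          (ℕₚ.n<1+n (even j))
      far′ seg₀ seg₁ p (s≤s ())
      far′ seg₁ seg₁ p (s≤s ())
      far′ seg₁ seg₂ p (s≤s (s≤s ()))
      far′ seg₂ seg₁ p (s≤s ())
      far′ seg₂ seg₂ p (s≤s (s≤s ()))
      far′ seg₂ seg₃ p (s≤s (s≤s (s≤s ())))
      far′ seg₃ seg₁ p (s≤s ())
      far′ seg₃ seg₂ p (s≤s (s≤s ()))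
      far′ seg₃ seg₃ p (s≤s (s≤s (s≤s ())))

  -- Which paths are disjoint

  consecutive-disjoint : ∀ {i j l} → i < j → j < l → l ≤ N → Disjoint (path i j) (path j l)
  consecutive-disjoint {i} {j} {l} i<j j<l l≤N (p , on , on′) = go on on′
    where
    j≤N : j ≤ N
    j≤N = ℕₚ.≤-trans (ℕₚ.<⇒≤ j<l) l≤N

    go : On (path i j) p → On (path j l) p → ⊥
    go (seg₀ , on) on′ =
      -- All of `path j l` lies in the quadrant `x , y ≥ 2j + 1`, whereas each of the first three
      -- segments of `path i j` has `y ≤ 2j` or `x ≤ 2j`.
      separated (seg-≤ Y i j seg₀ (odd i) on ℕₚ.≤-refl ℕₚ.≤-refl)
        (path-≥ Y j l (odd j) (corner-Y≥ j<l l≤N) on′) (odd-mono-< i<j)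
    go (seg₁ , on) on′ =
      separated (seg-≤ Y i j seg₁ (even j) on (ℕₚ.<⇒≤ (odd<even i<j)) ℕₚ.≤-refl)
        (path-≥ Y j l (odd j) (corner-Y≥ j<l l≤N) on′) (ℕₚ.n<1+n (even j))
    go (seg₂ , on) on′ =
      separated (seg-≤ X i j seg₂ (even j) on ℕₚ.≤-refl ℕₚ.≤-refl)
        (path-≥ X j l (odd j) (corner-X≥ j<l l≤N) on′) (ℕₚ.n<1+n (even j))
    go (seg₃ , on) (seg₀ , on′) =
      -- The antidiagonal stops at height `2j + 2`, one unit above the horizontal segment.
      separated (seg-≤ Y j l seg₀ (odd j) on′ ℕₚ.≤-refl ℕₚ.≤-refl)
        (seg-≥ Y i j seg₃ (suc (suc (even j))) on
          (s≤s (s≤s (ℕₚ.<⇒≤ (even-j<τ i<j j≤N)))) ℕₚ.≤-refl)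
        (ℕₚ.n<1+n (odd j))
    go (seg₃ , on) (suc s , on′) =
      -- After its first segment `path j l` stays at or below `level l`, which is less than
      -- `level j`.
      separated (seg-≤ X+Y j l (suc s) (level l) on′
          (after-first-X+Y≤ j<l l≤N (inject₁ s)) (after-first-X+Y≤ j<l l≤N (suc s)))
        (seg-≥ X+Y i j seg₃ (level j) on ℕₚ.≤-refl (ℕₚ.≤-reflexive (sym (level-corner₄ j))))
        (level-anti-< j<l l≤N)

  -- As `2i + 1 ≤ 2k + 1 < 2j`, the corner `(2k + 1 , 2k + 1)` of `path k l` lies on the diagonal
  -- segment of `path i j`.
  overlapping-meet : ∀ {i j k l} → i ≤ k → k < j → k < l → l ≤ N → ¬ Disjoint (path i j) (path k l)
  overlapping-meet {i} {j} {k} {l} i≤k k<j k<l l≤N disjoint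
    with ℕₚ.m≤n⇒∃[o]m+o≡n (ℕₚ.+-monoʳ-≤ 1 (even-mono-≤ i≤k))
       | ℕₚ.m≤n⇒∃[o]m+o≡n (odd<even k<j)
  ... | d , d≡ | e′ , e≡ =
    disjoint (embed (odd k , odd k) , (seg₁ , onDiagonal) , (seg₀ , onStart))
    where
    onDiagonal : OnSegment (embed (odd k , odd k)) (embed (odd i , odd i)) (embed (even j , even j))
    onDiagonal = subst₂ (λ m b → OnSegment (embed (m , m)) (embed (odd i , odd i)) (embed (b , b)))
      d≡ (trans (shift (odd i) d e′) (trans (cong (λ m → suc m +ℕ e′) d≡) e≡))
      (diagonal-∋ (odd i) d (suc e′) (ℕₚ.m≤n⇒m≤o+n d (s≤s z≤n)))
      where
      shift : ∀ a d e → a +ℕ (d +ℕ suc e) ≡ suc (a +ℕ d) +ℕ e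
      shift = solve-∀
    onStart : OnSegment (embed (odd k , odd k)) (embed (τ 0 , odd k)) (embed (odd k , odd k))
    onStart = 1ℚ , ℚₚ.<⇒≤ 0<1 , ℚₚ.≤-refl , end (ι (odd k)) (ι (τ 0)) , end (ι (odd k)) (ι (odd k))
      where
      end : ∀ b a → b ≡ a + 1ℚ * (b - a)
      end = solve 2 (λ b a → b := a :+ con 1ℚ :* (b :- a)) refl
        where open +-*-Solver

  -- The antidiagonal of `path i j` descends to `2j + 2 < 2k + 1`, so it passes height `2k + 1`;
  -- there its abscissa lies between `2k + 1` and `τ 0`.
  apart-meet : ∀ {i j k l} → j < k → k < l → l ≤ N → ¬ Disjoint (path i j) (path k l)
  apart-meet {i} {j} {k} {l} j<k k<l l≤N disjoint =
    disjoint (embed (even j +ℕ d , odd k) , (seg₃ , onLast) , (seg₀ , onFirst))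
    where
    odd-k≤evenN : odd k ≤ even N
    odd-k≤evenN = odd-i≤evenN k<l l≤N

    -- `e` is the height of the crossing above the lower end of the antidiagonal, and `d` its
    -- horizontal distance from the upper end.
    e-spec : ∃ λ e → suc (suc (even j)) +ℕ e ≡ odd k
    e-spec = ℕₚ.m≤n⇒∃[o]m+o≡n (ℕₚ.m≤n⇒m≤1+n (odd<even j<k))
    e = proj₁ e-spec

    e≤odd-k : even j +ℕ e ≤ odd k
    e≤odd-k = subst (even j +ℕ e ≤_) (proj₂ e-spec) (ℕₚ.m≤n⇒m≤1+n (ℕₚ.n≤1+n _))

    d-spec : ∃ λ d → suc (even j +ℕ e) +ℕ d ≡ τ j
    d-spec = ℕₚ.m≤n⇒∃[o]m+o≡n (≤evenN⇒<τ j (ℕₚ.≤-trans e≤odd-k odd-k≤evenN))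
    d = suc (proj₁ d-spec)

    end-x : even j +ℕ (d +ℕ e) ≡ τ j
    end-x = trans (rearrange (even j) (proj₁ d-spec) e) (proj₂ d-spec)
      where
      rearrange : ∀ a d e → a +ℕ (suc d +ℕ e) ≡ suc (a +ℕ e) +ℕ d
      rearrange = solve-∀

    onLast : OnSegment (embed (even j +ℕ d , odd k))
               (embed (even j , suc (suc (τ j)))) (embed (τ j , suc (suc (even j))))
    onLast = subst₂ (λ y t → OnSegment (embed (even j +ℕ d , y))
                               (embed (even j , suc (suc t))) (embed (t , suc (suc (even j)))))
      (proj₂ e-spec) end-x (antidiagonal-∋ (even j) (suc (suc (even j))) d e (s≤s z≤n))

    -- With `x` the abscissa of the crossing, `x + e = τ j > 4N ≥ (2k + 1) + e`.
    odd-k<x : odd k < even j +ℕ d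
    odd-k<x = ℕₚ.+-cancelʳ-< e (odd k) (even j +ℕ d)
      (subst (odd k +ℕ e <_) (trans (sym end-x) (sym (ℕₚ.+-assoc (even j) d e)))
        (ℕₚ.≤-<-trans
          (ℕₚ.+-mono-≤ odd-k≤evenN (ℕₚ.≤-trans (ℕₚ.m≤n+m e (even j)) (ℕₚ.≤-trans e≤odd-k odd-k≤evenN)))
          (evenevenN<τ j)))

    x≤τ0 : even j +ℕ d ≤ τ 0
    x≤τ0 = ℕₚ.≤-trans (ℕₚ.+-monoʳ-≤ (even j) (ℕₚ.m≤m+n d e))
             (ℕₚ.≤-trans (ℕₚ.≤-reflexive end-x) (τ≤τ0 j))

    -- `f` and `g` are the distances from the crossing to the left and right ends of the horizontal
    -- segment.
    f-spec : ∃ λ f → suc (odd k) +ℕ f ≡ even j +ℕ d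
    f-spec = ℕₚ.m≤n⇒∃[o]m+o≡n odd-k<x
    f = suc (proj₁ f-spec)

    g-spec : ∃ λ g → (even j +ℕ d) +ℕ g ≡ τ 0
    g-spec = ℕₚ.m≤n⇒∃[o]m+o≡n x≤τ0
    g = proj₁ g-spec

    x≡ : odd k +ℕ f ≡ even j +ℕ d
    x≡ = trans (ℕₚ.+-suc (odd k) _) (proj₂ f-spec)

    start-x : odd k +ℕ (g +ℕ f) ≡ τ 0
    start-x = trans (rearrange (odd k) g f) (trans (cong (_+ℕ g) x≡) (proj₂ g-spec))
      where
      rearrange : ∀ a g f → a +ℕ (g +ℕ f) ≡ (a +ℕ f) +ℕ g
      rearrange = solve-∀

    onFirst : OnSegment (embed (even j +ℕ d , odd k)) (embed (τ 0 , odd k)) (embed (odd k , odd k))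
    onFirst = subst₂ (λ x t → OnSegment (embed (x , odd k)) (embed (t , odd k)) (embed (odd k , odd k)))
      x≡ start-x (leftward-∋ (odd k) g f (odd k) (ℕₚ.m≤n⇒m≤o+n g (s≤s z≤n)))

  disjoint⇒consecutive-ordered : ∀ {i j k l} → i ≤ k → k < l → l ≤ N →
    Disjoint (path i j) (path k l) → j ≡ k
  disjoint⇒consecutive-ordered {j = j} {k} i≤k k<l l≤N disjoint with ℕₚ.<-cmp j k
  ... | tri< j<k _ _ = ⊥-elim (apart-meet j<k k<l l≤N disjoint)
  ... | tri≈ _ j≡k _ = j≡k
  ... | tri> _ _ k<j = ⊥-elim (overlapping-meet i≤k k<j k<l l≤N disjoint)

  disjoint⇒consecutive : ∀ {i j k l} → i < j → j ≤ N → k < l → l ≤ N →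
    Disjoint (path i j) (path k l) → j ≡ k ⊎ l ≡ i
  disjoint⇒consecutive {i} {k = k} i<j j≤N k<l l≤N disjoint with ℕₚ.≤-total i k
  ... | inj₁ i≤k = inj₁ (disjoint⇒consecutive-ordered i≤k k<l l≤N disjoint)
  ... | inj₂ k≤i = inj₂ (disjoint⇒consecutive-ordered k≤i i<j j≤N
                           λ (p , on , on′) → disjoint (p , on′ , on))

-- The finite family and its shift graph

-- Pairs are indexed by start and offset rather than by start and end, so that
-- every index decodes to a pair i < j.
module Family (n : ℕ) where

  -- Start and offset are both below `n`, which bounds every end by `n + n`.
  open Strings (n +ℕ n)

  start end : Fin (n *ℕ n) → ℕ
  start v = toℕ (proj₁ (remQuot {n} n v))
  end v   = suc (start v +ℕ toℕ (proj₂ (remQuot {n} n v)))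

  start<end : ∀ v → start v < end v
  start<end v = s≤s (ℕₚ.m≤m+n (start v) _)

  end≤n+n : ∀ v → end v ≤ n +ℕ n
  end≤n+n v = let i , g = remQuot {n} n v in ℕₚ.+-mono-≤ (Finₚ.toℕ<n i) (ℕₚ.<⇒≤ (Finₚ.toℕ<n g))

  strings : Fin (n *ℕ n) → Path
  strings v = path (start v) (end v)

  -- The pair `v` would both start and end at the start of `w`.
  no-transitive : ∀ u v w → end u ≡ start v → end v ≡ start w → end u ≡ start w → ⊥
  no-transitive u v w u→v v→w u→w = ℕₚ.<-irrefl (trans (sym u→v) (trans u→w (sym v→w))) (start<end v)

  -- Starts increase strictly from each pair to the next, so they cannot return.
  no-cycle : ∀ u v w → end u ≡ start v → end v ≡ start w → end w ≡ start u → ⊥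
  no-cycle u v w u→v v→w w→u = ℕₚ.<-irrefl refl (ℕₚ.<-trans (start<end u)
    (subst₂ _<_ (sym u→v) w→u (ℕₚ.<-trans (subst (start v <_) v→w (start<end v)) (start<end w))))

  adjacent⇒consecutive : ∀ u v → DisjAdj strings u v → end u ≡ start v ⊎ end v ≡ start u
  adjacent⇒consecutive u v (_ , disjoint) =
    disjoint⇒consecutive {start u} {end u} {start v} {end v}
      (start<end u) (end≤n+n u) (start<end v) (end≤n+n v) disjoint

  consecutive⇒adjacent : ∀ u v → end u ≡ start v → DisjAdj strings u v
  consecutive⇒adjacent u v u→v =
    (λ { refl → ℕₚ.<-irrefl (sym u→v) (start<end u) }) ,
    subst (λ j → Disjoint (path (start u) j) (strings v)) (sym u→v)
      (consecutive-disjoint (subst (start u <_) u→v (start<end u)) (start<end v) (end≤n+n v))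

  -- Each edge is oriented from the pair that ends where the other starts. Of the eight orientations
  -- of a triangle, six are transitive and two cyclic.
  triangle-free : DisjTriangleFree strings
  triangle-free a b c ab bc ac
    with adjacent⇒consecutive a b ab | adjacent⇒consecutive b c bc | adjacent⇒consecutive a c ac
  ... | inj₁ a→b | inj₁ b→c | inj₁ a→c = no-transitive a b c a→b b→c a→c
  ... | inj₁ a→b | inj₁ b→c | inj₂ c→a = no-cycle a b c a→b b→c c→a
  ... | inj₁ a→b | inj₂ c→b | inj₁ a→c = no-transitive a c b a→c c→b a→b
  ... | inj₁ a→b | inj₂ c→b | inj₂ c→a = no-transitive c a b c→a a→b c→b
  ... | inj₂ b→a | inj₁ b→c | inj₁ a→c = no-transitive b a c b→a a→c b→c
  ... | inj₂ b→a | inj₁ b→c | inj₂ c→a = no-transitive b c a b→c c→a b→a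
  ... | inj₂ b→a | inj₂ c→b | inj₁ a→c = no-cycle a c b a→c c→b b→a
  ... | inj₂ b→a | inj₂ c→b | inj₂ c→a = no-transitive c b a c→b b→a c→a

  offset<n : ∀ (h i : Fin n) → toℕ i ∸ suc (toℕ h) < n
  offset<n h i = ℕₚ.≤-<-trans (ℕₚ.m∸n≤m (toℕ i) (suc (toℕ h))) (Finₚ.toℕ<n i)

  -- The offset is one less than the difference, matching the `suc` in `end`. For `i ≤ h` truncated
  -- subtraction gives the default offset 0, and the result does not represent `(h , i)`.
  vertex : Fin n → Fin n → Fin (n *ℕ n)
  vertex h i = combine h (fromℕ< (offset<n h i))

  start-vertex : ∀ h i → start (vertex h i) ≡ toℕ h
  start-vertex h i = cong (toℕ ∘ proj₁) (Finₚ.remQuot-combine {n} {n} h _)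

  end-vertex : ∀ h i → toℕ h < toℕ i → end (vertex h i) ≡ toℕ i
  end-vertex h i h<i = begin
    end (vertex h i)
      ≡⟨ cong (λ (a , g) → suc (toℕ a +ℕ toℕ g)) (Finₚ.remQuot-combine {n} {n} h _) ⟩
    suc (toℕ h +ℕ toℕ (fromℕ< (offset<n h i)))
      ≡⟨ cong (λ g → suc (toℕ h +ℕ g)) (Finₚ.toℕ-fromℕ< (offset<n h i)) ⟩
    suc (toℕ h) +ℕ (toℕ i ∸ suc (toℕ h))
      ≡⟨ ℕₚ.m+[n∸m]≡n h<i ⟩
    toℕ i ∎
    where open ≡-Reasoning

  colouring-bound : ∀ m (c : Fin (n *ℕ n) → Fin m) → ProperColouring strings m c → n ≤ 2 ^ m
  colouring-bound m c proper = shift-colouring-bound (λ h i → c (vertex h i)) λ h i j h<i i<j →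
    proper (vertex h i) (vertex i j)
      (consecutive⇒adjacent _ _ (trans (end-vertex h i h<i) (sym (start-vertex i j))))

theorem5 : (k : ℕ) → 1 ≤ k →
    Σ ℕ λ n → Σ (Fin n → Path) λ S →
    ((i : Fin n) → Simple (S i)) × DisjTriangleFree S × ChromaticAtLeast S k
theorem5 k _ = n *ℕ n , strings ,
  (λ v → Strings.simple (n +ℕ n) (start<end v) (end≤n+n v)) ,
  triangle-free ,
  λ m m<k c proper → ℕₚ.<⇒≱ (ℕₚ.^-monoʳ-< 2 (s≤s (s≤s z≤n)) m<k) (colouring-bound m c proper)
  where
  -- A proper colouring with `m < k` colours would give `2 ^ k ≤ 2 ^ m`.
  n = 2 ^ k
  open Family n
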